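{- Let $A=(a_{ij})_{1\le i,j\le 2}\in M(2,\mathbb{Z})$ and put $$Q_A(x,y)=\frac{a_{12}x^2+(a_{22}-a_{11})xy-a_{21}y^2}{\gcd(a_{12},a_{21},a_{22}-a_{11})}.$$ Then $A$ is of Frobenius type if and only if there exist integers $x,y$ with $|Q_A(x,y)|=1$.
   Context: $M(2,\mathbb{Z})$ denotes the set of $2\times 2$ matrices with integer entries whose characteristic polynomial is irreducible over $\mathbb{Q}$. For integers $a_1,a_2$, the Frobenius matrix is $M_{a_1,a_2}=\begin{pmatrix} 0 & 1 \\ a_2 & a_1 \end{pmatrix}$. A matrix $A\in M(2,\mathbb{Z})$ is said to be of Frobenius type if there exist integers $a_1,a_2$ and a matrix $X\in SL(2,\mathbb{Z})$ such that $XAX^{ -1}$ commutes with $M_{a_1,a_2}$. -}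

module Defs where

open import Algebra.Bundles.Raw using (RawRing)
import Algebra.Definitions.RawSemiring as RawSemiringDefs
open import Data.Integer.Base as ℤ using (ℤ; 0ℤ; 1ℤ)
import Data.Integer.GCD as ℤ
import Data.Integer.Properties as ℤ
import Data.Integer.Tactic.RingSolver as ℤ-Solver
open import Data.List.Base using (List; []; _∷_; map)
open import Data.Nat.Base as ℕ using (ℕ; zero; suc)
open import Data.Product.Base using (Σ-syntax; ∃₂)
open import Data.Rational.Base as ℚ using (ℚ; 0ℚ; 1ℚ)
import Data.Rational.Properties as ℚ
open import Data.Rational.Solver using (module +-*-Solver)
open import Data.Sum.Base using (reduce)
open import Level using (0ℓ)
open import Relation.Nullary.Negation.Core using (¬_)
open import Relation.Binary.PropositionalEquality
  using (_≡_; refl; sym; trans; cong; cong₂; module ≡-Reasoning)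

-- Univariate polynomials as coefficient lists, constant term first.  Lists are
-- compared by their coefficients, so trailing zeros are irrelevant.

module Polynomial {c ℓ} (R : RawRing c ℓ) where
  open RawRing R

  coeff : List Carrier → ℕ → Carrier
  coeff []      n       = 0#
  coeff (a ∷ p) zero    = a
  coeff (a ∷ p) (suc n) = coeff p n

  add : List Carrier → List Carrier → List Carrier
  add []      q       = q
  add (a ∷ p) []      = a ∷ p
  add (a ∷ p) (b ∷ q) = (a + b) ∷ add p q

  mul : List Carrier → List Carrier → List Carrier
  mul []      q = []
  mul (a ∷ p) q = add (map (a *_) q) (0# ∷ mul p q)

  rawRing : RawRing c ℓ
  rawRing = record
    { Carrier = List Carrier
    ; _≈_     = λ p q → ∀ n → coeff p n ≈ coeff q n
    ; _+_     = add
    ; _*_     = mul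
    ; -_      = map (-_)
    ; 0#      = []
    ; 1#      = 1# ∷ []
    }

  const : Carrier → List Carrier
  const a = a ∷ []

  X : List Carrier
  X = 0# ∷ 1# ∷ []

record Mat₂ {a} (A : Set a) : Set a where
  constructor mat
  field
    a₁₁ a₁₂ a₂₁ a₂₂ : A

module _ {c ℓ} (R : RawRing c ℓ) where
  open RawRing R

  det : Mat₂ Carrier → Carrier
  det (mat a b c d) = (a * d) + (- (b * c))

ℚ[X] : RawRing 0ℓ 0ℓ
ℚ[X] = Polynomial.rawRing ℚ.+-*-rawRing

-- det (X·I − A) over ℚ[X]
charPoly : Mat₂ ℤ → RawRing.Carrier ℚ[X]
charPoly (mat a b c d) =
  det ℚ[X] (mat (X + - ι a) (- ι b)
                (- ι c)     (X + - ι d))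
  where
  open RawRing ℚ[X] using (_+_; -_)
  open Polynomial ℚ.+-*-rawRing using (const; X)
  ι : ℤ → RawRing.Carrier ℚ[X]
  ι i = const (i ℚ./ 1)

open RawSemiringDefs (RawRing.rawSemiring ℚ[X]) public
  using (Irreducible)

record M[2,ℤ] : Set where
  field
    matrix      : Mat₂ ℤ
    irreducible : Irreducible (charPoly matrix)
  open Mat₂ matrix public

infixl 7 _*ₘ_

_*ₘ_ : Mat₂ ℤ → Mat₂ ℤ → Mat₂ ℤ
mat a b c d *ₘ mat a′ b′ c′ d′ =
  mat (a ℤ.* a′ ℤ.+ b ℤ.* c′) (a ℤ.* b′ ℤ.+ b ℤ.* d′)
      (c ℤ.* a′ ℤ.+ d ℤ.* c′) (c ℤ.* b′ ℤ.+ d ℤ.* d′)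

1ₘ : Mat₂ ℤ
1ₘ = mat 1ℤ 0ℤ 0ℤ 1ℤ

record SL[2,ℤ] : Set where
  constructor _,_
  field
    matrix : Mat₂ ℤ
    det≡1  : det ℤ.+-*-rawRing matrix ≡ 1ℤ

infix 8 _⁻¹

_⁻¹ : SL[2,ℤ] → SL[2,ℤ]
(mat a b c d , det≡1) ⁻¹ =
  mat d (ℤ.- b) (ℤ.- c) a , trans (lemma a b c d) det≡1
  where
  lemma : ∀ a b c d → d ℤ.* a ℤ.+ ℤ.- (ℤ.- b ℤ.* ℤ.- c) ≡ a ℤ.* d ℤ.+ ℤ.- (b ℤ.* c)
  lemma = ℤ-Solver.solve-∀

private
  mat-cong : ∀ {a a′ b b′ c c′ d d′ : ℤ} → a ≡ a′ → b ≡ b′ → c ≡ c′ → d ≡ d′ →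
             mat a b c d ≡ mat a′ b′ c′ d′
  mat-cong refl refl refl refl = refl

⁻¹-inverseʳ : ∀ X → SL[2,ℤ].matrix X *ₘ SL[2,ℤ].matrix (X ⁻¹) ≡ 1ₘ
⁻¹-inverseʳ (mat a b c d , det≡1) =
  mat-cong (trans (e₁₁ a b c d) det≡1) (e₁₂ a b) (e₂₁ c d) (trans (e₂₂ a b c d) det≡1)
  where
  e₁₁ : ∀ a b c d → a ℤ.* d ℤ.+ b ℤ.* ℤ.- c ≡ a ℤ.* d ℤ.+ ℤ.- (b ℤ.* c)
  e₁₁ = ℤ-Solver.solve-∀
  e₁₂ : ∀ a b → a ℤ.* ℤ.- b ℤ.+ b ℤ.* a ≡ 0ℤ
  e₁₂ = ℤ-Solver.solve-∀
  e₂₁ : ∀ c d → c ℤ.* d ℤ.+ d ℤ.* ℤ.- c ≡ 0ℤ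
  e₂₁ = ℤ-Solver.solve-∀
  e₂₂ : ∀ a b c d → c ℤ.* ℤ.- b ℤ.+ d ℤ.* a ≡ a ℤ.* d ℤ.+ ℤ.- (b ℤ.* c)
  e₂₂ = ℤ-Solver.solve-∀

⁻¹-inverseˡ : ∀ X → SL[2,ℤ].matrix (X ⁻¹) *ₘ SL[2,ℤ].matrix X ≡ 1ₘ
⁻¹-inverseˡ (mat a b c d , det≡1) =
  mat-cong (trans (e₁₁ a b c d) det≡1) (e₁₂ b d) (e₂₁ a c) (trans (e₂₂ a b c d) det≡1)
  where
  e₁₁ : ∀ a b c d → d ℤ.* a ℤ.+ ℤ.- b ℤ.* c ≡ a ℤ.* d ℤ.+ ℤ.- (b ℤ.* c)
  e₁₁ = ℤ-Solver.solve-∀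
  e₁₂ : ∀ b d → d ℤ.* b ℤ.+ ℤ.- b ℤ.* d ≡ 0ℤ
  e₁₂ = ℤ-Solver.solve-∀
  e₂₁ : ∀ a c → ℤ.- c ℤ.* a ℤ.+ a ℤ.* c ≡ 0ℤ
  e₂₁ = ℤ-Solver.solve-∀
  e₂₂ : ∀ a b c d → ℤ.- c ℤ.* b ℤ.+ a ℤ.* d ≡ a ℤ.* d ℤ.+ ℤ.- (b ℤ.* c)
  e₂₂ = ℤ-Solver.solve-∀

conjugate : SL[2,ℤ] → Mat₂ ℤ → Mat₂ ℤ
conjugate X A = SL[2,ℤ].matrix X *ₘ A *ₘ SL[2,ℤ].matrix (X ⁻¹)

Commute : Mat₂ ℤ → Mat₂ ℤ → Set
Commute A B = A *ₘ B ≡ B *ₘ A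

frobenius : ℤ → ℤ → Mat₂ ℤ
frobenius a₁ a₂ = mat 0ℤ 1ℤ a₂ a₁

FrobeniusType : M[2,ℤ] → Set
FrobeniusType A = ∃₂ λ (a₁ a₂ : ℤ) → Σ[ X ∈ SL[2,ℤ] ]
  Commute (conjugate X (M[2,ℤ].matrix A)) (frobenius a₁ a₂)

content : Mat₂ ℤ → ℕ
content (mat a₁₁ a₁₂ a₂₁ a₂₂) = ℤ.∣ ℤ.gcd (ℤ.gcd a₁₂ a₂₁) (a₂₂ ℤ.- a₁₁) ∣

-- The content vanishes only for scalar matrices, and (X − a)² is reducible.

private
  module ℚ[X]ₘ = RawRing ℚ[X]
  open Polynomial ℚ.+-*-rawRing using (add; mul; coeff)
  open import Algebra.Definitions.RawMagma ℚ[X]ₘ.*-rawMagma using (_∣_; _,_)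

  eval : ℚ → List ℚ → ℚ
  eval x []      = 0ℚ
  eval x (a ∷ p) = a ℚ.+ x ℚ.* eval x p

  eval-≈[] : ∀ x p → (∀ n → coeff p n ≡ 0ℚ) → eval x p ≡ 0ℚ
  eval-≈[] x []      eq = refl
  eval-≈[] x (a ∷ p) eq rewrite eq 0 | eval-≈[] x p (λ n → eq (suc n)) =
    trans (ℚ.+-identityˡ _) (ℚ.*-zeroʳ x)

  eval-cong : ∀ x p q → p ℚ[X]ₘ.≈ q → eval x p ≡ eval x q
  eval-cong x []      q       eq = sym (eval-≈[] x q (λ n → sym (eq n)))
  eval-cong x (a ∷ p) []      eq = eval-≈[] x (a ∷ p) eq
  eval-cong x (a ∷ p) (b ∷ q) eq =
    cong₂ (λ u v → u ℚ.+ x ℚ.* v) (eq 0) (eval-cong x p q (λ n → eq (suc n)))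

  open +-*-Solver using (solve; _:=_; _:+_; _:*_; :-_; con)

  eval-add : ∀ x p q → eval x (add p q) ≡ eval x p ℚ.+ eval x q
  eval-add x []      q       = sym (ℚ.+-identityˡ _)
  eval-add x (a ∷ p) []      = sym (ℚ.+-identityʳ _)
  eval-add x (a ∷ p) (b ∷ q) rewrite eval-add x p q =
    solve 5 (λ x a b u v → (a :+ b) :+ x :* (u :+ v) := (a :+ x :* u) :+ (b :+ x :* v))
      refl x a b (eval x p) (eval x q)

  eval-scale : ∀ x a p → eval x (map (a ℚ.*_) p) ≡ a ℚ.* eval x p
  eval-scale x a []      = sym (ℚ.*-zeroʳ a)
  eval-scale x a (b ∷ p) rewrite eval-scale x a p =
    solve 4 (λ x a b u → a :* b :+ x :* (a :* u) := a :* (b :+ x :* u))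
      refl x a b (eval x p)

  eval-mul : ∀ x p q → eval x (mul p q) ≡ eval x p ℚ.* eval x q
  eval-mul x []      q = sym (ℚ.*-zeroˡ (eval x q))
  eval-mul x (a ∷ p) q = begin
    eval x (add (map (a ℚ.*_) q) (0ℚ ∷ mul p q))
      ≡⟨ eval-add x (map (a ℚ.*_) q) (0ℚ ∷ mul p q) ⟩
    eval x (map (a ℚ.*_) q) ℚ.+ (0ℚ ℚ.+ x ℚ.* eval x (mul p q))
      ≡⟨ cong₂ (λ u v → u ℚ.+ (0ℚ ℚ.+ x ℚ.* v)) (eval-scale x a q) (eval-mul x p q) ⟩
    a ℚ.* eval x q ℚ.+ (0ℚ ℚ.+ x ℚ.* (eval x p ℚ.* eval x q))
      ≡⟨ solve 4 (λ x a u v → a :* v :+ (con 0ℚ :+ x :* (u :* v)) := (a :+ x :* u) :* v)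
           refl x a (eval x p) (eval x q) ⟩
    (a ℚ.+ x ℚ.* eval x p) ℚ.* eval x q ∎
    where open ≡-Reasoning

  scalar-reducible : ∀ a → ¬ Irreducible (charPoly (mat a 0ℤ 0ℤ a))
  scalar-reducible a irr =
    l∤1 (reduce (RawSemiringDefs.Irreducible.split-∣1 irr {l} {l} square))
    where
    r : ℚ
    r = a ℚ./ 1

    l : List ℚ
    l = (0ℚ ℚ.+ ℚ.- r) ∷ 1ℚ ∷ []

    square : charPoly (mat a 0ℤ 0ℤ a) ℚ[X]ₘ.≈ mul l l
    square zero    = ℚ.+-identityʳ _
    square (suc n) = refl

    l∤1 : ¬ (l ∣ (1ℚ ∷ []))
    l∤1 (q , ql≈1) = 0≢1 (begin
      0ℚ
        ≡⟨ solve 2 (λ r u → con 0ℚ :=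
             u :* ((con 0ℚ :+ :- r) :+ r :* (con 1ℚ :+ r :* con 0ℚ))) refl r (eval r q) ⟩
      eval r q ℚ.* eval r l  ≡⟨ eval-mul r q l ⟨
      eval r (mul q l)       ≡⟨ eval-cong r (mul q l) (1ℚ ∷ []) ql≈1 ⟩
      1ℚ ℚ.+ r ℚ.* 0ℚ        ≡⟨ solve 1 (λ r → con 1ℚ :+ r :* con 0ℚ := con 1ℚ) refl r ⟩
      1ℚ                     ∎)
      where
      open ≡-Reasoning
      0≢1 : ¬ (0ℚ ≡ 1ℚ)
      0≢1 ()

content-nonZero : (A : M[2,ℤ]) → ℕ.NonZero (content (M[2,ℤ].matrix A))
content-nonZero A = ℕ.≢-nonZero λ eq → go (M[2,ℤ].matrix A) eq (M[2,ℤ].irreducible A)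
  where
  go : ∀ B → content B ≡ 0 → ¬ Irreducible (charPoly B)
  go (mat a b c d) eq irr
    with g≡0 ← ℤ.∣i∣≡0⇒i≡0 eq
    with h≡0 ← ℤ.gcd[i,j]≡0⇒i≡0 (ℤ.gcd b c) (d ℤ.- a) g≡0
    with refl ← ℤ.gcd[i,j]≡0⇒i≡0 b c h≡0
       | refl ← ℤ.gcd[i,j]≡0⇒j≡0 {b} {c} h≡0
       | refl ← ℤ.i-j≡0⇒i≡j d a (ℤ.gcd[i,j]≡0⇒j≡0 {ℤ.gcd b c} {d ℤ.- a} g≡0)
    = scalar-reducible a irr

-- The quotient is taken in ℚ, so nothing is truncated; it is in fact an integer.
Q : M[2,ℤ] → ℤ → ℤ → ℚ
Q A x y =
  (a₁₂ ℤ.* (x ℤ.* x) ℤ.+ (a₂₂ ℤ.- a₁₁) ℤ.* (x ℤ.* y) ℤ.- a₂₁ ℤ.* (y ℤ.* y))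
    ℚ./ content matrix
  where
  open M[2,ℤ] A
  instance _ = content-nonZero A

{-# OPTIONS --safe #-}

-- A 2×2 matrix commutes with some Frobenius matrix exactly when its upper right
-- entry q divides the lower left entry and the difference of the diagonal
-- entries, i.e. when the matrix is scalar modulo q.  The moduli e for which A is
-- scalar are the divisors of the content g of A and do not change under
-- conjugation by SL(2,ℤ), and g always divides q.  So A is of Frobenius type iff
-- some conjugate has upper right entry ±g.  If X has first row (x, y), the upper
-- right entry of X A X⁻¹ is g · Q_A(x, y).  Conversely |Q_A(x, y)| = 1 forces x
-- and y to be coprime, so that (x, y) is the first row of some X.
module Submission where

open import Defs
open import Data.Integer.Base
  using (ℤ; +_; 0ℤ; 1ℤ; _+_; _-_; -_; _*_)
  renaming (∣_∣ to ∣_∣ᶻ)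
open import Data.Integer.Divisibility.Signed
  using (divides; ∣⇒∣ᵤ; ∣ᵤ⇒∣; ∣-refl; m∣∣m∣; ∣m∣n⇒∣m+n; ∣m∣n⇒∣m-n; ∣m⇒∣m*n)
import Data.Integer.Divisibility.Signed as ℤ using (_∣_)
import Data.Integer.GCD as ℤ
import Data.Integer.Properties as ℤ
open import Data.Integer.Tactic.RingSolver using (solve-∀)
open import Data.Nat.Base as ℕ using (ℕ; suc)
import Data.Nat.Divisibility as ℕ
import Data.Nat.GCD as ℕ
import Data.Nat.Properties as ℕ
open import Data.Product.Base using (∃₂; _×_; _,_)
open import Data.Rational.Base as ℚ using (∣_∣; 1ℚ)
import Data.Rational.Properties as ℚ
import Data.Rational.Unnormalised.Base as ℚᵘ
import Data.Rational.Unnormalised.Properties as ℚᵘ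
open import Function.Base using (_$_)
open import Function.Bundles using (_⇔_; mk⇔; Equivalence)
open import Relation.Binary.PropositionalEquality
  using (_≡_; refl; sym; trans; cong; cong₂; subst; module ≡-Reasoning)

open Equivalence using (to; from)

-- `i ℚ./ n` is reduced to lowest terms, which hides `i` and `n`; in the unnormalised rationals
-- equality is plain cross-multiplication.
∣i/n∣≡1⇔∣i∣≡n : ∀ i n .{{_ : ℕ.NonZero n}} → ∣ i ℚ./ n ∣ ≡ 1ℚ ⇔ ∣ i ∣ᶻ ≡ n
∣i/n∣≡1⇔∣i∣≡n i n@(suc _) = mk⇔ ⇒ ⇐
  where
  ∣i/n∣≃ : ℚ.toℚᵘ ∣ i ℚ./ n ∣ ℚᵘ.≃ ℚᵘ.∣ i ℚᵘ./ n ∣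
  ∣i/n∣≃ = ℚᵘ.≃-trans (ℚ.toℚᵘ-homo-∣-∣ (i ℚ./ n))
                      (ℚᵘ.∣-∣-cong (ℚ.toℚᵘ-fromℚᵘ (i ℚᵘ./ n)))

  ⇒ : ∣ i ℚ./ n ∣ ≡ 1ℚ → ∣ i ∣ᶻ ≡ n
  ⇒ eq with ℚᵘ.*≡* e ← ℚᵘ.≃-trans (ℚᵘ.≃-sym ∣i/n∣≃) (ℚ.toℚᵘ-cong eq) =
    ℤ.+-injective (trans (sym (ℤ.*-identityʳ _)) (trans e (ℤ.*-identityˡ _)))

  ⇐ : ∣ i ∣ᶻ ≡ n → ∣ i ℚ./ n ∣ ≡ 1ℚ
  ⇐ eq = ℚ.toℚᵘ-injective $ ℚᵘ.≃-trans ∣i/n∣≃ $ ℚᵘ.*≡* $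
    trans (ℤ.*-identityʳ _) (trans (cong +_ eq) (sym (ℤ.*-identityˡ _)))

-- Carries a Bézout identity over ℕ, phrased there without subtraction, to ℤ; `u` and `v` will be
-- `σ * x` and `τ * y` in either order.
difference≡1 : ∀ {m n u v} i → + m ≡ u → ∀ j → + n ≡ v →
               1 ℕ.+ j ℕ.* n ≡ i ℕ.* m → + i * u - + j * v ≡ 1ℤ
difference≡1 {m} {n} i refl j refl eq = begin
  + i * + m - + j * + n         ≡⟨ cong₂ _-_ (ℤ.pos-* i m) (ℤ.pos-* j n) ⟨
  + (i ℕ.* m) - + (j ℕ.* n)     ≡⟨ cong (λ k → + k - + (j ℕ.* n)) eq ⟨
  1ℤ + + (j ℕ.* n) - + (j ℕ.* n)  ≡⟨ cancel (+ (j ℕ.* n)) ⟩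
  1ℤ                            ∎
  where
  open ≡-Reasoning
  cancel : ∀ u → 1ℤ + u - u ≡ 1ℤ
  cancel = solve-∀

bézout : ∀ x y → ℕ.gcd ∣ x ∣ᶻ ∣ y ∣ᶻ ≡ 1 → ∃₂ λ z w → x * w + - (y * z) ≡ 1ℤ
bézout x y gcd≡1
  -- `σ` and `τ` act as the signs of `x` and `y`; they are absorbed into `z` and `w` below.
  with divides σ ∣x∣≡σx ← m∣∣m∣ {x} | divides τ ∣y∣≡τy ← m∣∣m∣ {y}
  with ℕ.Bézout.identity (subst (ℕ.GCD ∣ x ∣ᶻ ∣ y ∣ᶻ) gcd≡1 (ℕ.gcd-GCD ∣ x ∣ᶻ ∣ y ∣ᶻ))
... | ℕ.Bézout.+- i j eq = + j * τ , + i * σ ,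
  trans (regroup x y (+ i) (+ j) σ τ) (difference≡1 i ∣x∣≡σx j ∣y∣≡τy eq)
  where
  regroup : ∀ x y i j σ τ →
    x * (i * σ) + - (y * (j * τ)) ≡ i * (σ * x) - j * (τ * y)
  regroup = solve-∀
... | ℕ.Bézout.-+ i j eq = - (+ j * τ) , - (+ i * σ) ,
  trans (regroup x y (+ i) (+ j) σ τ) (difference≡1 j ∣y∣≡τy i ∣x∣≡σx eq)
  where
  regroup : ∀ x y i j σ τ →
    x * - (i * σ) + - (y * - (j * τ)) ≡ j * (τ * y) - i * (σ * x)
  regroup = solve-∀

-- The modulus is an integer because it will be a matrix entry; signed divisibility keeps the
-- quotients, which become `a₁` and `a₂`.
ScalarModulo : ℤ → Mat₂ ℤ → Set
ScalarModulo e (mat a b c d) = e ℤ.∣ b × e ℤ.∣ c × e ℤ.∣ d - a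

scalarModulo⇔∣content : ∀ e A → ScalarModulo e A ⇔ ∣ e ∣ᶻ ℕ.∣ content A
scalarModulo⇔∣content e (mat a b c d) = mk⇔
  (λ (e∣b , e∣c , e∣d-a) →
    ℕ.gcd-greatest (ℕ.gcd-greatest (∣⇒∣ᵤ e∣b) (∣⇒∣ᵤ e∣c)) (∣⇒∣ᵤ e∣d-a))
  (λ e∣g → let e∣gcd[b,c] = ℕ.∣-trans e∣g (ℤ.gcd[i,j]∣i (ℤ.gcd b c) (d - a)) in
      ∣ᵤ⇒∣ (ℕ.∣-trans e∣gcd[b,c] (ℤ.gcd[i,j]∣i b c))
    , ∣ᵤ⇒∣ (ℕ.∣-trans e∣gcd[b,c] (ℤ.gcd[i,j]∣j b c))
    , ∣ᵤ⇒∣ (ℕ.∣-trans e∣g (ℤ.gcd[i,j]∣j (ℤ.gcd b c) (d - a))))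

-- Comparing the first rows of the two products gives `r = a₂ * q` and `s - p = a₁ * q`; the second
-- rows then agree automatically.
frobenius-commute⇔scalarModulo : ∀ C →
  (∃₂ λ a₁ a₂ → Commute C (frobenius a₁ a₂)) ⇔ ScalarModulo (Mat₂.a₁₂ C) C
frobenius-commute⇔scalarModulo (mat p q r s) = mk⇔ ⇒ ⇐
  where
  ⇒ : (∃₂ λ a₁ a₂ → Commute (mat p q r s) (frobenius a₁ a₂)) → q ℤ.∣ q × q ℤ.∣ r × q ℤ.∣ s - p
  ⇒ (a₁ , a₂ , eq) = ∣-refl
    , divides a₂ (trans (r≡ p r) (trans (sym (cong Mat₂.a₁₁ eq)) (qa₂≡ p q a₂)))
    , divides a₁ (trans (s-p≡ p q s) (trans (cong (_- p) (sym (cong Mat₂.a₁₂ eq))) (a₁q≡ p q a₁)))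
    where
    r≡ : ∀ p r → r ≡ 0ℤ * p + 1ℤ * r
    r≡ = solve-∀
    qa₂≡ : ∀ p q a₂ → p * 0ℤ + q * a₂ ≡ a₂ * q
    qa₂≡ = solve-∀
    s-p≡ : ∀ p q s → s - p ≡ (0ℤ * q + 1ℤ * s) - p
    s-p≡ = solve-∀
    a₁q≡ : ∀ p q a₁ → (p * 1ℤ + q * a₁) - p ≡ a₁ * q
    a₁q≡ = solve-∀

  s≡ : ∀ p s → s ≡ (s - p) + p
  s≡ = solve-∀

  ⇐ : q ℤ.∣ q × q ℤ.∣ r × q ℤ.∣ s - p → ∃₂ λ a₁ a₂ → Commute (mat p q r s) (frobenius a₁ a₂)
  ⇐ (_ , divides a₂ refl , divides a₁ s-p≡a₁q)
    -- Solving for the variable `s` allows it to be eliminated, which leaves only ring identities.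
    with refl ← trans (s≡ p s) (cong (_+ p) s-p≡a₁q) = a₁ , a₂ , commute
    where
    e₁₁ : ∀ p q a₂ → p * 0ℤ + q * a₂ ≡ 0ℤ * p + 1ℤ * (a₂ * q)
    e₁₁ = solve-∀
    e₁₂ : ∀ p q a₁ → p * 1ℤ + q * a₁ ≡ 0ℤ * q + 1ℤ * (a₁ * q + p)
    e₁₂ = solve-∀
    e₂₁ : ∀ p q a₁ a₂ → (a₂ * q) * 0ℤ + (a₁ * q + p) * a₂ ≡ a₂ * p + a₁ * (a₂ * q)
    e₂₁ = solve-∀
    e₂₂ : ∀ p q a₁ a₂ →
      (a₂ * q) * 1ℤ + (a₁ * q + p) * a₁ ≡ a₂ * q + a₁ * (a₁ * q + p)
    e₂₂ = solve-∀
    commute : Commute (mat p q (a₂ * q) (a₁ * q + p)) (frobenius a₁ a₂)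
    commute rewrite e₁₁ p q a₂ | e₁₂ p q a₁ | e₂₁ p q a₁ a₂ | e₂₂ p q a₁ a₂ = refl

∣-linear : ∀ {e u v t} k l m → e ℤ.∣ u → e ℤ.∣ v → e ℤ.∣ t → e ℤ.∣ u * k + v * l - t * m
∣-linear k l m e∣u e∣v e∣t =
  ∣m∣n⇒∣m-n (∣m∣n⇒∣m+n (∣m⇒∣m*n k e∣u) (∣m⇒∣m*n l e∣v)) (∣m⇒∣m*n m e∣t)

-- The numerator of `Q`, arranged as there so that the two agree definitionally.
form : Mat₂ ℤ → ℤ → ℤ → ℤ
form (mat a b c d) x y = b * (x * x) + (d - a) * (x * y) - c * (y * y)

-- The second column of the inverse is `(- y, x)`, so only the first row of the conjugating matrix
-- enters.
conjugate-a₁₂ : ∀ x y z w (D≡1 : x * w + - (y * z) ≡ 1ℤ) A →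
  Mat₂.a₁₂ (conjugate (mat x y z w , D≡1) A) ≡ form A x y
conjugate-a₁₂ x y z w _ (mat a b c d) = expand x y a b c d
  where
  expand : ∀ x y a b c d →
    (x * a + y * c) * (- y) + (x * b + y * d) * x
      ≡ b * (x * x) + (d - a) * (x * y) - c * (y * y)
  expand = solve-∀

-- Scalar matrices contribute nothing to the off-diagonal entries and the diagonal difference of a
-- conjugate, so these are linear in `b`, `d - a` and `c`.
scalarModulo-conjugate : ∀ {e} X A → ScalarModulo e A → ScalarModulo e (conjugate X A)
scalarModulo-conjugate {e} (mat x y z w , D≡1) A@(mat a b c d) (e∣b , e∣c , e∣d-a) =
    subst (e ℤ.∣_) (sym (conjugate-a₁₂ x y z w D≡1 A)) (∣-linear (x * x) (x * y) (y * y) e∣b e∣d-a e∣c)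
  , subst (e ℤ.∣_) (sym (e₂₁ z w a b c d)) (∣-linear (- (z * z)) (- (z * w)) (- (w * w)) e∣b e∣d-a e∣c)
  , subst (e ℤ.∣_) (sym (e₂₂-e₁₁ x y z w a b c d))
      (∣-linear (+ 2 * (x * z)) (x * w + y * z) (+ 2 * (y * w)) e∣b e∣d-a e∣c)
  where
  e₂₁ : ∀ z w a b c d →
    (z * a + w * c) * w + (z * b + w * d) * (- z)
      ≡ b * (- (z * z)) + (d - a) * (- (z * w)) - c * (- (w * w))
  e₂₁ = solve-∀
  e₂₂-e₁₁ : ∀ x y z w a b c d →
    ((z * a + w * c) * (- y) + (z * b + w * d) * x)
      - ((x * a + y * c) * w + (x * b + y * d) * (- z))
      ≡ b * (+ 2 * (x * z)) + (d - a) * (x * w + y * z) - c * (+ 2 * (y * w))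
  e₂₂-e₁₁ = solve-∀

scalarModulo-conjugate⁻¹ : ∀ {e} X A → ScalarModulo e (conjugate X A) → ScalarModulo e A
scalarModulo-conjugate⁻¹ {e} (mat x y z w , D≡1) (mat a b c d) (e∣q , e∣r , e∣s-p) =
    descend (e₁₂ x y z w a b c d) (∣-linear (w * w) (- (w * y)) (y * y) e∣q e∣s-p e∣r)
  , descend (e₂₁ x y z w a b c d) (∣-linear (- (z * z)) (z * x) (- (x * x)) e∣q e∣s-p e∣r)
  , descend (e₂₂-e₁₁ x y z w a b c d)
      (∣-linear (- (+ 2 * (w * z))) (x * w + y * z) (- (+ 2 * (y * x))) e∣q e∣s-p e∣r)
  where
  -- Conjugating back with the adjugate in place of the inverse multiplies A by D²,
  -- which makes the identities below valid without the hypothesis D ≡ 1.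
  D : ℤ
  D = x * w + - (y * z)

  descend : ∀ {i j} → D * D * i ≡ j → e ℤ.∣ j → e ℤ.∣ i
  descend {i} D²i≡j = subst (e ℤ.∣_) (trans (sym D²i≡j)
    (trans (cong (λ k → k * k * i) D≡1) (ℤ.*-identityˡ i)))

  e₁₂ : ∀ x y z w a b c d →
    (x * w + - (y * z)) * (x * w + - (y * z)) * b ≡
      ((x * a + y * c) * (- y) + (x * b + y * d) * x) * (w * w)
      + (((z * a + w * c) * (- y) + (z * b + w * d) * x)
           - ((x * a + y * c) * w + (x * b + y * d) * (- z))) * (- (w * y))
      - ((z * a + w * c) * w + (z * b + w * d) * (- z)) * (y * y)
  e₁₂ = solve-∀
  e₂₁ : ∀ x y z w a b c d →
    (x * w + - (y * z)) * (x * w + - (y * z)) * c ≡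
      ((x * a + y * c) * (- y) + (x * b + y * d) * x) * (- (z * z))
      + (((z * a + w * c) * (- y) + (z * b + w * d) * x)
           - ((x * a + y * c) * w + (x * b + y * d) * (- z))) * (z * x)
      - ((z * a + w * c) * w + (z * b + w * d) * (- z)) * (- (x * x))
  e₂₁ = solve-∀
  e₂₂-e₁₁ : ∀ x y z w a b c d →
    (x * w + - (y * z)) * (x * w + - (y * z)) * (d - a) ≡
      ((x * a + y * c) * (- y) + (x * b + y * d) * x) * (- (+ 2 * (w * z)))
      + (((z * a + w * c) * (- y) + (z * b + w * d) * x)
           - ((x * a + y * c) * w + (x * b + y * d) * (- z))) * (x * w + y * z)
      - ((z * a + w * c) * w + (z * b + w * d) * (- z)) * (- (+ 2 * (y * x)))
  e₂₂-e₁₁ = solve-∀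

content-∣-form : ∀ A x y → content A ℕ.∣ ∣ form A x y ∣ᶻ
content-∣-form A@(mat a b c d) x y
  with g∣b , g∣c , g∣d-a ← from (scalarModulo⇔∣content (+ content A) A) ℕ.∣-refl =
  ∣⇒∣ᵤ (∣-linear (x * x) (x * y) (y * y) g∣b g∣d-a g∣c)

-- The form is homogeneous of degree two, so `e * e` splits off and leaves a value that the content
-- still divides.
commonDivisor²-∣-form : ∀ {e} A x y → + e ℤ.∣ x → + e ℤ.∣ y →
                        e ℕ.* e ℕ.* content A ℕ.∣ ∣ form A x y ∣ᶻ
commonDivisor²-∣-form {e} A@(mat a b c d) _ _ (divides x refl) (divides y refl) =
  subst (e ℕ.* e ℕ.* content A ℕ.∣_) (sym ∣form∣≡) (ℕ.*-monoʳ-∣ (e ℕ.* e) (content-∣-form A x y))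
  where
  open ≡-Reasoning
  homogeneous : ∀ e x y a b c d →
    b * (x * e * (x * e)) + (d - a) * (x * e * (y * e)) - c * (y * e * (y * e))
      ≡ e * e * (b * (x * x) + (d - a) * (x * y) - c * (y * y))
  homogeneous = solve-∀
  ∣form∣≡ : ∣ form A (x * + e) (y * + e) ∣ᶻ ≡ e ℕ.* e ℕ.* ∣ form A x y ∣ᶻ
  ∣form∣≡ = begin
    ∣ form A (x * + e) (y * + e) ∣ᶻ        ≡⟨ cong ∣_∣ᶻ (homogeneous (+ e) x y a b c d) ⟩
    ∣ + e * + e * form A x y ∣ᶻ            ≡⟨ ℤ.abs-* (+ e * + e) (form A x y) ⟩
    ∣ + e * + e ∣ᶻ ℕ.* ∣ form A x y ∣ᶻ     ≡⟨ cong (ℕ._* ∣ form A x y ∣ᶻ) (ℤ.abs-* (+ e) (+ e)) ⟩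
    e ℕ.* e ℕ.* ∣ form A x y ∣ᶻ            ∎

-- If `e` is the gcd, `e * e` times the content divides the content; cancelling the nonzero content
-- makes `e * e` a divisor of 1.
∣form∣≡content⇒coprime : ∀ A x y .{{_ : ℕ.NonZero (content A)}} →
                         ∣ form A x y ∣ᶻ ≡ content A → ℕ.gcd ∣ x ∣ᶻ ∣ y ∣ᶻ ≡ 1
∣form∣≡content⇒coprime A x y ∣form∣≡g = ℕ.m*n≡1⇒m≡1 e e $ ℕ.∣1⇒≡1 $ ℕ.*-cancelʳ-∣ (content A) $
  subst (e ℕ.* e ℕ.* content A ℕ.∣_) (trans ∣form∣≡g (sym (ℕ.*-identityˡ (content A))))
    (commonDivisor²-∣-form A x y (∣ᵤ⇒∣ (ℤ.gcd[i,j]∣i x y)) (∣ᵤ⇒∣ (ℤ.gcd[i,j]∣j x y)))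
  where
  e : ℕ
  e = ℕ.gcd ∣ x ∣ᶻ ∣ y ∣ᶻ

-- Commuting makes the conjugate, hence `A`, scalar modulo `form A x y`, so this value divides the
-- content, which always divides it in turn.
frobenius-conjugate⇔∣form∣≡content : ∀ x y z w (D≡1 : x * w + - (y * z) ≡ 1ℤ) A →
  (∃₂ λ a₁ a₂ → Commute (conjugate (mat x y z w , D≡1) A) (frobenius a₁ a₂))
    ⇔ ∣ form A x y ∣ᶻ ≡ content A
frobenius-conjugate⇔∣form∣≡content x y z w D≡1 A = mk⇔
  (λ commute → ℕ.∣-antisym
    (to (scalarModulo⇔∣content (form A x y) A)
      (scalarModulo-conjugate⁻¹ X A
        (subst (λ e → ScalarModulo e C) C₁₂≡
          (to (frobenius-commute⇔scalarModulo C) commute))))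
    (content-∣-form A x y))
  (λ ∣form∣≡g → from (frobenius-commute⇔scalarModulo C)
    (subst (λ e → ScalarModulo e C) (sym C₁₂≡)
      (scalarModulo-conjugate X A
        (from (scalarModulo⇔∣content (form A x y) A) (ℕ.∣-reflexive ∣form∣≡g)))))
  where
  X : SL[2,ℤ]
  X = mat x y z w , D≡1

  C : Mat₂ ℤ
  C = conjugate X A

  C₁₂≡ : Mat₂.a₁₂ C ≡ form A x y
  C₁₂≡ = conjugate-a₁₂ x y z w D≡1 A

theorem2 : (A : M[2,ℤ]) →
    FrobeniusType A ⇔ (∃₂ λ (x y : ℤ) → ∣ Q A x y ∣ ≡ 1ℚ)
theorem2 A = mk⇔
  (λ { (a₁ , a₂ , (mat x y z w , D≡1) , commute) → x , y ,
       from (∣Q∣≡1⇔ x y)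
         (to (frobenius-conjugate⇔∣form∣≡content x y z w D≡1 matrix) (a₁ , a₂ , commute)) })
  (λ (x , y , ∣Q∣≡1) →
    let ∣form∣≡g = to (∣Q∣≡1⇔ x y) ∣Q∣≡1
        z , w , D≡1 = bézout x y (∣form∣≡content⇒coprime matrix x y ∣form∣≡g)
        a₁ , a₂ , commute = from (frobenius-conjugate⇔∣form∣≡content x y z w D≡1 matrix) ∣form∣≡g
    in a₁ , a₂ , (mat x y z w , D≡1) , commute)
  where
  open M[2,ℤ] A using (matrix)
  instance _ = content-nonZero A

  ∣Q∣≡1⇔ : ∀ x y → ∣ Q A x y ∣ ≡ 1ℚ ⇔ ∣ form matrix x y ∣ᶻ ≡ content matrix
  ∣Q∣≡1⇔ x y = ∣i/n∣≡1⇔∣i∣≡n (form matrix x y) (content matrix)
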